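{- For every $n\in\mathbb{N}$, $\tilde{R}(\dot Q_2^{(brbb)},Q_n)=\tilde{R}(\dot Q_2^{(brrb)},Q_n)=\tilde{R}(\dot Q_2^{(rrbb)},Q_n)=2n$, and $2n\le \tilde{R}(\dot Q_2^{(rbbb)},Q_n)\le 2n + O\big(\tfrac{n}{\log n}\big)$.
   Context: $Q_N$ denotes the Boolean lattice of all subsets of an $N$-element set ordered by inclusion. An (induced) copy of a poset $P$ in a poset $Q$ is a subset of $Q$ which, with the inherited order, is isomorphic to $P$. A colored poset $\dot P$ is a poset with a coloring of its elements in blue and red; a copy of $\dot P$ in a colored $Q$ is an induced copy of $P$ whose vertices have the same colors as the corresponding vertices of $\dot P$. $\dot Q_n^{(b)}$ (resp. $\dot Q_n^{(r)}$) is $Q_n$ colored entirely blue (resp. red). $\tilde{R}(\dot P,Q_n)$ is the minimum $N$ such that every blue/red coloring of $Q_N$ contains a copy of $\dot P$, of $\dot Q_n^{(b)}$, or of $\dot Q_n^{(r)}$. Write $Q_2=\{\varnothing,\{1\},\{2\},\{1,2\}\}$. For letters $w,x,y,z\in\{b,r\}$ (b = blue, r = red), $\dot Q_2^{(wxyz)}$ denotes $Q_2$ with $\varnothing$ colored $w$, $\{1\}$ colored $x$, $\{2\}$ colored $y$, and $\{1,2\}$ colored $z$. Thus $\dot Q_2^{(brbb)}$ has exactly one red vertex, a middle one; $\dot Q_2^{(brrb)}$ has both middle vertices red and minimum and maximum blue; $\dot Q_2^{(rrbb)}$ has red minimum, one red and one blue middle vertex, and blue maximum; $\dot Q_2^{(rbbb)}$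 has red minimum and all other vertices blue. Logarithms are base 2. -}

module Defs where

open import Data.Nat using (ℕ; zero; suc; _+_; _*_; _≤_; _<_)
open import Data.Nat.Logarithm using (⌊log₂_⌋)
open import Data.Fin.Subset using (Subset; _⊆_; inside; outside)
open import Data.Vec using (Vec; []; _∷_)
open import Data.Product using (_×_; Σ; ∃; ∃-syntax)
open import Data.Sum using (_⊎_)
open import Relation.Nullary using (¬_)
open import Relation.Binary.PropositionalEquality using (_≡_)
open import Function.Bundles using (_⇔_)

data Colour : Set where
  blue red : Colour

-- The Boolean lattice Q_N is  Subset N  (subsets of Fin N) ordered by _⊆_.
-- A colouring of Q_N.
Colouring : ℕ → Set
Colouring N = Subset N → Colour

record CopyOf {k N : ℕ} (col : Subset k → Colour) (c : Colouring N) : Set where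
  field
    emb       : Subset k → Subset N
    injective : ∀ x y → emb x ≡ emb y → x ≡ y
    orderEmb  : ∀ x y → (x ⊆ y) ⇔ (emb x ⊆ emb y)
    colours   : ∀ x → c (emb x) ≡ col x

mono : ∀ {n} → Colour → Subset n → Colour
mono a _ = a

Arrows : ∀ {k} → (Subset k → Colour) → ℕ → ℕ → Set
Arrows col n N =
  (c : Colouring N) →
    CopyOf col c ⊎ CopyOf (mono {n} blue) c ⊎ CopyOf (mono {n} red) c

IsRtilde : ∀ {k} → (Subset k → Colour) → ℕ → ℕ → Set
IsRtilde col n N = Arrows col n N × (∀ M → M < N → ¬ Arrows col n M)

-- Coloured Q_2^{(wxyz)}:  ∅ ↦ w,  {1} ↦ x,  {2} ↦ y,  {1,2} ↦ z.
-- Element 1 is index 0 (first vector entry), element 2 is index 1.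
Q2col : Colour → Colour → Colour → Colour → Subset 2 → Colour
Q2col w x y z (outside ∷ outside ∷ []) = w
Q2col w x y z (inside  ∷ outside ∷ []) = x
Q2col w x y z (outside ∷ inside  ∷ []) = y
Q2col w x y z (inside  ∷ inside  ∷ []) = z

Q2-brbb Q2-brrb Q2-rrbb Q2-rbbb : Subset 2 → Colour
Q2-brbb = Q2col blue red  blue blue
Q2-brrb = Q2col blue red  red  blue
Q2-rrbb = Q2col red  red  blue blue
Q2-rbbb = Q2col red  blue blue blue

{-# OPTIONS --safe #-}
module Submission where

-- Lower bound: in the colouring "blue iff fewer than n elements" every chain of either colour has at most n
-- members, and no red set lies below a blue one, whereas each of the four patterns has a red vertex below a
-- blue one.
--
-- Upper bounds: split the ground set into blocks. A family F T i, increasing in T and i and determining the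
-- order of T, contains either a red Qₙ of the form T ↦ F T (g T) or a blue chain F T₀ 0, F T₁ 1, …
-- * brbb: take F T i = T ∪ (first i elements). The sets T_|S| ∪ S form a blue Qₙ, since such a set is equal
--   or incomparable to the chain member of the same rank.
-- * brrb: a column {T ∪ S : S} that is entirely blue is a blue Qₙ; otherwise pick a red set in each column. A
--   blue T ∪ ⊥ and a blue T′ ∪ ⊤ with T ⊂ T′ force a blue Qₙ, and in their absence the choice can be made
--   monotone.
-- * rrbb: an interval from a red to a blue set has a monochromatic interior. Applied above a minimal red A this
--   lets one new coordinate z repair all red sets of a block: S ↦ S ∪ {z} as soon as S contains a red set.
-- * rbbb: above a red set in the first block blue must not contain Λ (two incomparable sets below a third). The
--   chain lemma, run along more than 2ⁿ different orders of k = O(n / log n) coordinates, yields two blue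
--   chains with the same top by pigeonhole, hence a Λ.

open import Defs
open import Data.Empty using (⊥-elim)
open import Data.Fin using (Fin; zero; suc)
import Data.Fin as Fin hiding (_≟_)
import Data.Fin.Properties as Fin
open import Data.Fin.Subset using (Subset; _⊆_; _⊈_; _⊂_; _∈_; _∉_; _∪_; _∩_; ∁; ⊥; ⊤; ⁅_⁆; ∣_∣; inside; outside)
open import Data.Fin.Subset.Properties
open import Data.Nat using (ℕ; zero; suc; _+_; _*_; _∸_; _≤_; _<_; z≤n; s≤s; s≤s⁻¹; _≤?_; _^_; ⌊_/2⌋; ⌈_/2⌉; NonZero; >-nonZero)
open import Data.Nat.DivMod using (_/_; _%_; m≡m%n+[m/n]*n; m%n<n; m/n*n≤m)
open import Data.Nat.Logarithm using (⌊log₂_⌋; ⌊log₂⌋-mono-≤; ⌊log₂⌊n/2⌋⌋≡⌊log₂n⌋∸1)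
open import Data.Nat.Solver using (module +-*-Solver)
open +-*-Solver using (solve; _:+_; _:*_; _:=_; con)
import Data.Nat.Properties as ℕ
open import Data.Product using (_×_; ∃; ∃-syntax; _,_; proj₁; proj₂)
open import Data.Sum using (_⊎_; inj₁; inj₂)
open import Data.Unit using (tt) renaming (⊤ to Unit)
open import Data.Vec using (Vec; []; _∷_; _++_; here; there)
open import Data.Vec.Properties using (∷-injectiveˡ; ∷-injectiveʳ)
open import Function.Bundles using (mk⇔; Equivalence)
open import Relation.Nullary using (¬_; Dec; yes; no)
open import Relation.Nullary.Decidable using (¬?; _×-dec_; decidable-stable)
open import Relation.Binary.Definitions using (tri<; tri≈; tri>)
open import Relation.Unary using (Decidable)
open import Relation.Binary.PropositionalEquality using (_≡_; _≢_; refl; sym; trans; cong; cong₂; subst)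

private
  variable
    m n N k : ℕ

-- Colours and finite subsets

infix 4 _≟_

_≟_ : (a b : Colour) → Dec (a ≡ b)
blue ≟ blue = yes refl
blue ≟ red  = no λ ()
red  ≟ blue = no λ ()
red  ≟ red  = yes refl

¬red⇒blue : ∀ {a} → a ≢ red → a ≡ blue
¬red⇒blue {blue} _ = refl
¬red⇒blue {red}  h = ⊥-elim (h refl)

¬blue⇒red : ∀ {a} → a ≢ blue → a ≡ red
¬blue⇒red {blue} h = ⊥-elim (h refl)
¬blue⇒red {red}  _ = refl

clash : {A : Set} {a : Colour} → a ≡ blue → a ≡ red → A
clash refl ()

⊈⇒∃ : {p q : Subset n} → p ⊈ q → ∃[ x ] x ∈ p × x ∉ q
⊈⇒∃ {p = []}          {[]}          h = ⊥-elim (h λ x → x)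
⊈⇒∃ {p = outside ∷ p} {_ ∷ q}       h with x , x∈p , x∉q ← ⊈⇒∃ (λ s → h (out⊆ s)) = suc x , there x∈p , λ { (there x∈q) → x∉q x∈q }
⊈⇒∃ {p = inside ∷ p}  {inside ∷ q}  h with x , x∈p , x∉q ← ⊈⇒∃ (λ s → h (in⊆in s)) = suc x , there x∈p , λ { (there x∈q) → x∉q x∈q }
⊈⇒∃ {p = inside ∷ p}  {outside ∷ q} h = zero , here , λ ()

⊆∧⊉⇒⊂ : {p q : Subset n} → p ⊆ q → q ⊈ p → p ⊂ q
⊆∧⊉⇒⊂ p⊆q q⊈p = p⊆q , ⊈⇒∃ q⊈p

⊂⇒⊉ : {p q : Subset n} → p ⊂ q → q ⊈ p
⊂⇒⊉ (_ , x , x∈q , x∉p) q⊆p = x∉p (q⊆p x∈q)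

⊆∧≢⇒⊂ : {p q : Subset n} → p ⊆ q → p ≢ q → p ⊂ q
⊆∧≢⇒⊂ p⊆q p≢q = ⊆∧⊉⇒⊂ p⊆q λ q⊆p → p≢q (⊆-antisym p⊆q q⊆p)

⊆∧∣∣≡⇒≡ : {p q : Subset n} → p ⊆ q → ∣ p ∣ ≡ ∣ q ∣ → p ≡ q
⊆∧∣∣≡⇒≡ {p = p} {q} p⊆q eq with q ⊆? p
... | yes q⊆p = ⊆-antisym p⊆q q⊆p
... | no q⊈p  = ⊥-elim (ℕ.<⇒≢ (p⊂q⇒∣p∣<∣q∣ (⊆∧⊉⇒⊂ p⊆q q⊈p)) eq)

∪-least : {p q r : Subset n} → p ⊆ r → q ⊆ r → p ∪ q ⊆ r
∪-least {p = p} {q} p⊆r q⊆r x∈ with x∈p∪q⁻ p q x∈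
... | inj₁ x∈p = p⊆r x∈p
... | inj₂ x∈q = q⊆r x∈q

⁅⁆⊆ : {x : Fin n} {p : Subset n} → x ∈ p → ⁅ x ⁆ ⊆ p
⁅⁆⊆ {x = x} x∈p y∈ with refl ← x∈⁅y⁆⇒x≡y x y∈ = x∈p

++-⊆ : {p p′ : Subset m} {q q′ : Subset n} → p ⊆ p′ → q ⊆ q′ → p ++ q ⊆ p′ ++ q′
++-⊆ {p = []}    {[]}     _    q⊆q′ x∈         = q⊆q′ x∈
++-⊆ {p = _ ∷ _} {_ ∷ _}  p⊆p′ q⊆q′ (there x∈) = there (++-⊆ (drop-∷-⊆ p⊆p′) q⊆q′ x∈)
++-⊆ {p = _ ∷ _} {_ ∷ p′} p⊆p′ q⊆q′ here with here ← p⊆p′ here = here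

++-⊆ˡ : {p p′ : Subset m} {q q′ : Subset n} → p ++ q ⊆ p′ ++ q′ → p ⊆ p′
++-⊆ˡ {p = _ ∷ _} {_ ∷ _} h here with here ← h here = here
++-⊆ˡ {p = _ ∷ _} {_ ∷ _} h (there x∈) = there (++-⊆ˡ (drop-∷-⊆ h) x∈)

++-⊆ʳ : (p p′ : Subset m) {q q′ : Subset n} → p ++ q ⊆ p′ ++ q′ → q ⊆ q′
++-⊆ʳ []      []       h = h
++-⊆ʳ (_ ∷ p) (_ ∷ p′) h = ++-⊆ʳ p p′ (drop-∷-⊆ h)

initial : ∀ n → ℕ → Subset n
initial zero    _       = []
initial (suc n) zero    = outside ∷ initial n zero
initial (suc n) (suc i) = inside ∷ initial n i

initial-mono : ∀ n {i j} → i ≤ j → initial n i ⊆ initial n j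
initial-mono (suc n) {j = zero}  z≤n       = out⊆ (initial-mono n z≤n)
initial-mono (suc n) {j = suc j} z≤n       = out⊆ (initial-mono n z≤n)
initial-mono (suc n)             (s≤s i≤j) = in⊆in (initial-mono n i≤j)

∣initial∣ : ∀ n {i} → i ≤ n → ∣ initial n i ∣ ≡ i
∣initial∣ zero    z≤n       = refl
∣initial∣ (suc n) z≤n       = ∣initial∣ n z≤n
∣initial∣ (suc n) (s≤s i≤n) = cong suc (∣initial∣ n i≤n)

minimal : {P : Subset n → Set} → Decidable P → ∃ P →
          ∃[ S ] P S × (∀ {T} → T ⊂ S → ¬ P T)
minimal {P = P} P? (S , pS) = go ∣ S ∣ S ℕ.≤-refl pS
  where
  go : ∀ b S → ∣ S ∣ ≤ b → P S → ∃[ S ] P S × (∀ {T} → T ⊂ S → ¬ P T)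
  go b S ∣S∣≤b pS with anySubset? (λ T → T ⊂? S ×-dec P? T)
  go b       S ∣S∣≤b pS | no none = S , pS , λ {T} T⊂S pT → none (T , T⊂S , pT)
  go zero    S ∣S∣≤b pS | yes (T , T⊂S , pT) =
    ⊥-elim (ℕ.n≮0 (ℕ.<-≤-trans (p⊂q⇒∣p∣<∣q∣ T⊂S) ∣S∣≤b))
  go (suc b) S ∣S∣≤b pS | yes (T , T⊂S , pT) =
    go b T (s≤s⁻¹ (ℕ.<-≤-trans (p⊂q⇒∣p∣<∣q∣ T⊂S) ∣S∣≤b)) pT

-- Constructing copies

module _ {N} {c : Colouring N} where

  copy : {col : Subset k → Colour} (f : Subset k → Subset N) →
         (∀ {S T} → S ⊆ T → f S ⊆ f T) → (∀ {S T} → f S ⊆ f T → S ⊆ T) →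
         (∀ S → c (f S) ≡ col S) → CopyOf col c
  copy f mon ref col = record
    { emb       = f
    ; injective = λ S T eq → ⊆-antisym (ref {S} {T} (⊆-reflexive eq)) (ref {T} {S} (⊆-reflexive (sym eq)))
    ; orderEmb  = λ S T → mk⇔ (mon {S} {T}) (ref {S} {T})
    ; colours   = col
    }

  -- Incomparability of `q` and `r` makes all inclusions strict: `q ⊆ p`, for example, would give
  -- `q ⊆ r`. Every failure of order reflection reduces to `q ⊆ r` or `r ⊆ q`.
  diamond : ∀ {w x y z p q r s} → p ⊆ q → p ⊆ r → q ⊆ s → r ⊆ s → q ⊈ r → r ⊈ q →
            c p ≡ w → c q ≡ x → c r ≡ y → c s ≡ z → CopyOf (Q2col w x y z) c
  diamond {w} {x} {y} {z} {p} {q} {r} {s} p⊆q p⊆r q⊆s r⊆s q⊈r r⊈q cp cq cr cs =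
    copy f (λ {S} {T} → mon S T) (λ {S} {T} → ref S T) col
    where
    f : Subset 2 → Subset N
    f (outside ∷ outside ∷ []) = p
    f (inside  ∷ outside ∷ []) = q
    f (outside ∷ inside  ∷ []) = r
    f (inside  ∷ inside  ∷ []) = s

    p⊆ : ∀ S → p ⊆ f S
    p⊆ (outside ∷ outside ∷ []) = ⊆-refl
    p⊆ (inside  ∷ outside ∷ []) = p⊆q
    p⊆ (outside ∷ inside  ∷ []) = p⊆r
    p⊆ (inside  ∷ inside  ∷ []) = ⊆-trans p⊆q q⊆s

    ⊆s : ∀ S → f S ⊆ s
    ⊆s (outside ∷ outside ∷ []) = ⊆-trans p⊆q q⊆s
    ⊆s (inside  ∷ outside ∷ []) = q⊆s
    ⊆s (outside ∷ inside  ∷ []) = r⊆s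
    ⊆s (inside  ∷ inside  ∷ []) = ⊆-refl

    mon : ∀ S T → S ⊆ T → f S ⊆ f T
    mon (outside ∷ outside ∷ []) T                          h = p⊆ T
    mon S                          (inside  ∷ inside  ∷ []) h = ⊆s S
    mon (inside  ∷ outside ∷ []) (inside  ∷ outside ∷ []) h = ⊆-refl
    mon (outside ∷ inside  ∷ []) (outside ∷ inside  ∷ []) h = ⊆-refl
    mon (inside  ∷ _)            (outside ∷ _)            h with () ← h here
    mon (_ ∷ inside ∷ _)         (_ ∷ outside ∷ _)        h with there () ← h (there here)

    q⊆ : ∀ a → q ⊆ f (inside ∷ a ∷ [])
    q⊆ outside = ⊆-refl
    q⊆ inside  = q⊆s

    r⊆ : ∀ a → r ⊆ f (a ∷ inside ∷ [])
    r⊆ outside = ⊆-refl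
    r⊆ inside  = r⊆s

    ⊆q : ∀ a → f (a ∷ outside ∷ []) ⊆ q
    ⊆q outside = p⊆q
    ⊆q inside  = ⊆-refl

    ⊆r : ∀ a → f (outside ∷ a ∷ []) ⊆ r
    ⊆r outside = p⊆r
    ⊆r inside  = ⊆-refl

    ref : ∀ S T → f S ⊆ f T → S ⊆ T
    ref _                 (inside ∷ _)            h here         = here
    ref (_ ∷ a ∷ [])      (outside ∷ b ∷ [])      h here         = ⊥-elim (q⊈r (⊆-trans (q⊆ a) (⊆-trans h (⊆r b))))
    ref _                 (_ ∷ inside ∷ _)        h (there here) = there here
    ref (a ∷ _ ∷ [])      (b ∷ outside ∷ [])      h (there here) = ⊥-elim (r⊈q (⊆-trans (r⊆ a) (⊆-trans h (⊆q b))))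

    col : ∀ S → c (f S) ≡ Q2col w x y z S
    col (outside ∷ outside ∷ []) = cp
    col (inside  ∷ outside ∷ []) = cq
    col (outside ∷ inside  ∷ []) = cr
    col (inside  ∷ inside  ∷ []) = cs

module _ {m n} {c : Colouring (m + n)} {a : Colour} where

  -- The coordinate `S` itself reflects the order, so `g` has only to be monotone.
  graphˡ : (g : Subset n → Subset m) → (∀ {S T} → S ⊆ T → g S ⊆ g T) →
           (∀ S → c (g S ++ S) ≡ a) → CopyOf (mono {n} a) c
  graphˡ g g-mono = copy (λ S → g S ++ S) (λ h → ++-⊆ (g-mono h) h)
                         (λ {S} {T} h → ++-⊆ʳ (g S) (g T) h)

  graphʳ : (g : Subset m → Subset n) → (∀ {S T} → S ⊆ T → g S ⊆ g T) →
           (∀ S → c (S ++ g S) ≡ a) → CopyOf (mono {m} a) c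
  graphʳ g g-mono = copy (λ S → S ++ g S) (λ h → ++-⊆ h (g-mono h)) (λ h → ++-⊆ˡ h)

-- Lower bound

-- The images of the initial segments form a strict chain, so each step gains an element.
embedding-height : {c : Colouring N} {a : Colour} (e : CopyOf (mono {n} a) c) →
                   ∀ i → i ≤ n → i + ∣ CopyOf.emb e (initial n 0) ∣ ≤ ∣ CopyOf.emb e (initial n i) ∣
embedding-height e zero    _   = ℕ.≤-refl
embedding-height {n = n} e (suc i) i<n =
  ℕ.≤-<-trans (embedding-height e i (ℕ.<⇒≤ i<n)) (p⊂q⇒∣p∣<∣q∣ step)
  where
  open CopyOf e
  step : emb (initial n i) ⊂ emb (initial n (suc i))
  step = ⊆∧≢⇒⊂ (Equivalence.to (orderEmb _ _) (initial-mono n (ℕ.n≤1+n i))) λ eq →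
    ℕ.<⇒≢ (ℕ.n<1+n i) (trans (sym (∣initial∣ n (ℕ.<⇒≤ i<n)))
      (trans (cong ∣_∣ (injective _ _ eq)) (∣initial∣ n i<n)))

threshold : ∀ n → Colouring N
threshold n S with n ≤? ∣ S ∣
... | yes _ = red
... | no  _ = blue

threshold-red : {S : Subset N} → threshold n S ≡ red → n ≤ ∣ S ∣
threshold-red {n = n} {S} eq with n ≤? ∣ S ∣
... | yes n≤ = n≤

threshold-blue : {S : Subset N} → threshold n S ≡ blue → ∣ S ∣ < n
threshold-blue {n = n} {S} eq with n ≤? ∣ S ∣
... | no n≰ = ℕ.≰⇒> n≰

lower-bound : {col : Subset k → Colour} {S T : Subset k} → S ⊆ T → col S ≡ red → col T ≡ blue →
              ∀ n M → M < 2 * n → ¬ Arrows col n M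
lower-bound {S = S} {T} S⊆T colS colT n M M<2n arrows with arrows (threshold n)
... | inj₁ e = ℕ.<⇒≱ (threshold-blue (trans (colours T) colT))
      (ℕ.≤-trans (threshold-red (trans (colours S) colS)) (p⊆q⇒∣p∣≤∣q∣ (Equivalence.to (orderEmb S T) S⊆T)))
  where open CopyOf e
... | inj₂ (inj₁ e) = ℕ.<⇒≱ (threshold-blue (colours (initial n n)))
      (ℕ.≤-trans (ℕ.m≤m+n n _) (embedding-height e n ℕ.≤-refl))
  where open CopyOf e
-- A red copy starts at size at least `n` and climbs `n` more steps, so its top has at least 2n > M
-- elements.
... | inj₂ (inj₂ e) = ℕ.<⇒≱ M<2n (ℕ.≤-trans
      (ℕ.+-monoʳ-≤ n (ℕ.≤-trans (ℕ.≤-reflexive (ℕ.+-identityʳ n)) (threshold-red (colours (initial n 0)))))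
      (ℕ.≤-trans (embedding-height e n ℕ.≤-refl) (∣p∣≤n (emb (initial n n)))))
  where open CopyOf e

-- The chain lemma

-- Index `k` is included, so the chain has k + 1 members; `level` is total to avoid carrying bounds.
record BlueChain {m N} (c : Colouring N) (F : Subset m → ℕ → Subset N) (k : ℕ) : Set where
  field
    level      : ℕ → Subset m
    level-mono : ∀ {i j} → i ≤ j → level i ⊆ level j
    level-blue : ∀ {i} → i ≤ k → c (F (level i) i) ≡ blue

module _ {m N} (c : Colouring N) (F : Subset m → ℕ → Subset N)
         (F-mono : ∀ {S T i j} → S ⊆ T → i ≤ j → F S i ⊆ F T j)
         (F-reflects : ∀ {S T i j} → F S i ⊆ F T j → S ⊆ T) where

  private
    -- A blue chain of `i` members, with indices 0, ..., i - 1 and levels inside `T`, listed from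
    -- its top.
    Reach : ℕ → Subset m → Set
    Reach zero    T = Unit
    Reach (suc i) T = ∃[ S ] S ⊆ T × c (F S i) ≡ blue × Reach i S

    reach? : ∀ i → Decidable (Reach i)
    reach? zero    T = yes tt
    reach? (suc i) T = anySubset? λ S → S ⊆? T ×-dec (c (F S i) ≟ blue ×-dec reach? i S)

    reach-mono : ∀ i {S T} → S ⊆ T → Reach i S → Reach i T
    reach-mono zero    _   _               = tt
    reach-mono (suc i) S⊆T (R , R⊆S , b , r) = R , ⊆-trans R⊆S S⊆T , b , r

    -- The largest length (at most k) of a blue chain below T. The set F T (height k T) is red, as it would
    -- otherwise extend such a chain.
    height : ℕ → Subset m → ℕ
    height zero    T = 0
    height (suc k) T with reach? (suc k) T
    ... | yes _ = suc k
    ... | no  _ = height k T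

    height-≤ : ∀ k T → height k T ≤ k
    height-≤ zero    T = z≤n
    height-≤ (suc k) T with reach? (suc k) T
    ... | yes _ = ℕ.≤-refl
    ... | no  _ = ℕ.m≤n⇒m≤1+n (height-≤ k T)

    height-mono : ∀ k {S T} → S ⊆ T → height k S ≤ height k T
    height-mono zero    S⊆T = z≤n
    height-mono (suc k) {S} {T} S⊆T with reach? (suc k) S | reach? (suc k) T
    ... | yes _  | yes _  = ℕ.≤-refl
    ... | no _   | yes _  = ℕ.m≤n⇒m≤1+n (height-≤ k S)
    ... | no _   | no _   = height-mono k S⊆T
    ... | yes rS | no ¬rT = ⊥-elim (¬rT (reach-mono (suc k) S⊆T rS))

    height-red : ∀ k T → ¬ Reach (suc k) T → c (F T (height k T)) ≡ red
    height-red zero    T ¬r = ¬blue⇒red λ b → ¬r (T , ⊆-refl , b , tt)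
    height-red (suc k) T ¬r with reach? (suc k) T
    ... | yes r  = ¬blue⇒red λ b → ¬r (T , ⊆-refl , b , r)
    ... | no ¬r′ = height-red k T ¬r′

    -- The bound by `T` is the induction invariant: for the shorter chain it puts all earlier levels
    -- below the new top level `S`.
    extract : ∀ k {T} → Reach (suc k) T → ∃[ C ] (∀ i → BlueChain.level {c = c} {F} {k} C i ⊆ T)
    extract zero (S , S⊆T , b , _) = record
      { level      = λ _ → S
      ; level-mono = λ _ → ⊆-refl
      ; level-blue = λ { z≤n → b }
      } , λ _ → S⊆T
    extract (suc k) {T} (S , S⊆T , b , r) with C , C⊆S ← extract k r = record
      { level      = level′
      ; level-mono = mono′
      ; level-blue = blue′
      } , λ i → ⊆-trans (⊆S i) S⊆T
      where
      open BlueChain C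
      level′ : ℕ → Subset m
      level′ i with i ≤? k
      ... | yes _ = level i
      ... | no  _ = S
      ⊆S : ∀ i → level′ i ⊆ S
      ⊆S i with i ≤? k
      ... | yes _ = C⊆S i
      ... | no  _ = ⊆-refl
      mono′ : ∀ {i j} → i ≤ j → level′ i ⊆ level′ j
      mono′ {i} {j} i≤j with j ≤? k
      ... | no _ = ⊆S i
      ... | yes j≤k with i ≤? k
      ...   | yes _  = level-mono i≤j
      ...   | no i≰k = ⊥-elim (i≰k (ℕ.≤-trans i≤j j≤k))
      blue′ : ∀ {i} → i ≤ suc k → c (F (level′ i) i) ≡ blue
      blue′ {i} i≤1+k with i ≤? k
      ... | yes i≤k = level-blue i≤k
      ... | no i≰k with refl ← ℕ.≤-antisym i≤1+k (ℕ.≰⇒> i≰k) = b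

  -- If no chain has k + 1 members, `height` selects a red set for each `T`, monotonically.
  -- `F-reflects` allows different second arguments, so unequal heights do not disturb the order.
  chain-lemma : ∀ k → CopyOf (mono {m} red) c ⊎ BlueChain c F k
  chain-lemma k with anySubset? (reach? (suc k))
  ... | yes (_ , r) = inj₂ (proj₁ (extract k r))
  ... | no none = inj₁ (copy (λ T → F T (height k T))
          (λ S⊆T → F-mono S⊆T (height-mono k S⊆T)) (λ h → F-reflects h)
          (λ T → height-red k T λ r → none (T , r)))

-- The pattern brbb

brbb-arrows : ∀ n → Arrows Q2-brbb n (n + n)
brbb-arrows n c with chain-lemma c (λ T i → T ++ initial n i)
  (λ S⊆T i≤j → ++-⊆ S⊆T (initial-mono n i≤j)) (λ h → ++-⊆ˡ h) n
... | inj₁ r = inj₂ (inj₂ r)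
... | inj₂ C with anySubset? (λ S → c (BlueChain.level C ∣ S ∣ ++ S) ≟ red)
  where open BlueChain C
... | no none = inj₂ (inj₁ (graphˡ (λ S → level ∣ S ∣) (λ h → level-mono (p⊆q⇒∣p∣≤∣q∣ h))
                  λ S → ¬red⇒blue λ r → none (S , r)))
  where open BlueChain C
-- The red set and the chain member of its rank have second parts of equal size that differ, as the
-- colours do, so they are incomparable. The ends of the chain give minimum and maximum.
... | yes (S , r) = inj₁ (diamond
  (++-⊆ (level-mono z≤n) (subst (_⊆ S) (sym initial₀) ⊥⊆))
  (++-⊆ (level-mono z≤n) (initial-mono n z≤n))
  (++-⊆ (level-mono (∣p∣≤n S)) (subst (S ⊆_) (sym initialₙ) ⊆⊤))
  (++-⊆ (level-mono (∣p∣≤n S)) (initial-mono n (∣p∣≤n S)))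
  (λ h → distinct (⊆∧∣∣≡⇒≡ (++-⊆ʳ (level ∣ S ∣) _ h) (sym ∣init∣)))
  (λ h → distinct (sym (⊆∧∣∣≡⇒≡ (++-⊆ʳ (level ∣ S ∣) _ h) ∣init∣)))
  (level-blue z≤n) r (level-blue (∣p∣≤n S)) (level-blue ℕ.≤-refl))
  where
  open BlueChain C
  ∣init∣ : ∣ initial n ∣ S ∣ ∣ ≡ ∣ S ∣
  ∣init∣ = ∣initial∣ n (∣p∣≤n S)
  initial₀ : initial n 0 ≡ ⊥
  initial₀ = sym (⊆∧∣∣≡⇒≡ ⊥⊆ (trans (∣⊥∣≡0 n) (sym (∣initial∣ n z≤n))))
  initialₙ : initial n n ≡ ⊤
  initialₙ = ∣p∣≡n⇒p≡⊤ (∣initial∣ n ℕ.≤-refl)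
  distinct : S ≢ initial n ∣ S ∣
  distinct eq = clash (subst (λ T → c (level ∣ S ∣ ++ T) ≡ blue) (sym eq) (level-blue (∣p∣≤n S))) r

-- The pattern brrb

module _ {m n} (T T′ : Subset m) (x : Fin n) where

  private
    side : {A : Set} → Dec A → Subset m
    side (yes _) = T′
    side (no  _) = T

  -- The choice between `T` and `T′` encodes membership of `x`, which frees the second block of `x`.
  trade : Subset n → Subset (m + n)
  trade S = side (x ∈? S) ++ (S ∩ ∁ ⁅ x ⁆)

  ∖-⊆ : (S : Subset n) → S ∩ ∁ ⁅ x ⁆ ⊆ S
  ∖-⊆ S = p∩q⊆p S _

  x∉∖ : (S : Subset n) → x ∉ S ∩ ∁ ⁅ x ⁆
  x∉∖ S x∈ = x∈∁p⇒x∉p (proj₂ (x∈p∩q⁻ S _ x∈)) (x∈⁅x⁆ x)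

  ∖⁺ : {S : Subset n} {y : Fin n} → y ∈ S → y ≢ x → y ∈ S ∩ ∁ ⁅ x ⁆
  ∖⁺ y∈S y≢x = x∈p∩q⁺ (y∈S , x∉p⇒x∈∁p (λ y∈ → y≢x (x∈⁅y⁆⇒x≡y x y∈)))

  trade-mono : T ⊆ T′ → ∀ {S S′} → S ⊆ S′ → trade S ⊆ trade S′
  trade-mono T⊆T′ {S} {S′} S⊆S′ =
    ++-⊆ (side-⊆ (x ∈? S) (x ∈? S′) S⊆S′)
         (λ y∈ → ∖⁺ (S⊆S′ (∖-⊆ S y∈)) λ { refl → x∉∖ S y∈ })
    where
    side-⊆ : {A B : Set} (p : Dec A) (q : Dec B) → (A → B) → side p ⊆ side q
    side-⊆ (yes _) (yes _) f = ⊆-refl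
    side-⊆ (no _)  (yes _) f = T⊆T′
    side-⊆ (no _)  (no _)  f = ⊆-refl
    side-⊆ (yes a) (no ¬b) f = ⊥-elim (¬b (f a))

  trade-reflects : T′ ⊈ T → ∀ {S S′} → trade S ⊆ trade S′ → S ⊆ S′
  trade-reflects T′⊈T {S} {S′} h {y} y∈S with y Fin.≟ x
  ... | no y≢x = ∖-⊆ S′ (++-⊆ʳ (side (x ∈? S)) (side (x ∈? S′)) h (∖⁺ y∈S y≢x))
  ... | yes refl with x ∈? S | x ∈? S′
  ...   | _      | yes x∈S′ = x∈S′
  ...   | no x∉S | no _     = ⊥-elim (x∉S y∈S)
  ...   | yes _  | no _     = ⊥-elim (T′⊈T (++-⊆ˡ h))

  trade-⊇ : T ⊆ T′ → ∀ S → T ++ ⊥ ⊆ trade S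
  trade-⊇ T⊆T′ S with x ∈? S
  ... | yes _ = ++-⊆ T⊆T′ ⊥⊆
  ... | no  _ = ++-⊆ {p = T} ⊆-refl ⊥⊆

  trade-⊆ : T ⊆ T′ → ∀ S → trade S ⊆ T′ ++ ⊤
  trade-⊆ T⊆T′ S with x ∈? S
  ... | yes _ = ++-⊆ {p = T′} ⊆-refl ⊆⊤
  ... | no  _ = ++-⊆ T⊆T′ ⊆⊤

  -- Without a copy of brrb the red sets between T ++ ⊥ and T′ ++ ⊤ form a chain, so they all contain the element
  -- x of the minimal one, which no set in the image of trade does.
  trade-red : {c : Colouring (m + n)} {S₀ : Subset n} → T ⊂ T′ → x ∈ S₀ →
              c (T ++ ⊥) ≡ blue → c (T′ ++ ⊤) ≡ blue → c (T ++ S₀) ≡ red →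
              (∀ {S} → S ⊂ S₀ → c (T ++ S) ≢ red) →
              ∀ S → c (trade S) ≡ red → CopyOf Q2-brrb c
  trade-red {c} {S₀} T⊂T′ x∈S₀ b b′ r₀ S₀-min S r =
    diamond (++-⊆ {p = T} ⊆-refl ⊥⊆) (trade-⊇ T⊆T′ S) (++-⊆ T⊆T′ ⊆⊤) (trade-⊆ T⊆T′ S)
      (λ h → x∉∖ S (++-⊆ʳ T _ h x∈S₀)) (λ h → upper h r) b r₀ r b′
    where
    T⊆T′ : T ⊆ T′
    T⊆T′ = p⊂q⇒p⊆q T⊂T′
    -- The first part is then `T`, and the second misses `x ∈ S₀`, so it is proper in `S₀` and
    -- minimality forbids red.
    upper : trade S ⊆ T ++ S₀ → c (trade S) ≢ red
    upper h with x ∈? S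
    ... | yes _ = λ _ → ⊂⇒⊉ T⊂T′ (++-⊆ˡ h)
    ... | no  _ = S₀-min (++-⊆ʳ T T h , x , x∈S₀ , x∉∖ S)

-- A minimal red `S₀` in the column of `T` is non-empty because `T ++ ⊥` is blue. Any `x` in it
-- gives a `trade` embedding, which is blue throughout or meets a red set completing brrb.
far-pair : {c : Colouring (m + n)} {T T′ : Subset m} → T ⊂ T′ →
           c (T ++ ⊥) ≡ blue → c (T′ ++ ⊤) ≡ blue →
           CopyOf Q2-brrb c ⊎ CopyOf (mono {n} blue) c
far-pair {n = n} {c} {T} {T′} T⊂T′ b b′ with anySubset? (λ S → c (T ++ S) ≟ red)
... | no none = inj₂ (graphˡ (λ _ → T) (λ _ → ⊆-refl) λ S → ¬red⇒blue λ r → none (S , r))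
... | yes reds with S₀ , r₀ , S₀-min ← minimal (λ S → c (T ++ S) ≟ red) reds with nonempty? S₀
...   | no empty = clash (subst (λ S → c (T ++ S) ≡ blue) (sym (Empty-unique empty)) b) r₀
...   | yes (x , x∈S₀) with anySubset? (λ S → c (trade T T′ x S) ≟ red)
...     | yes (S , r) = inj₁ (trade-red T T′ x T⊂T′ x∈S₀ b b′ r₀ S₀-min S r)
...     | no none = inj₂ (copy (trade T T′ x)
            (trade-mono T T′ x (p⊂q⇒p⊆q T⊂T′)) (trade-reflects T T′ x (⊂⇒⊉ T⊂T′))
            λ S → ¬red⇒blue λ r → none (S , r))

brrb-arrows : ∀ n → Arrows Q2-brrb n (n + n)
brrb-arrows n c
  with anySubset? (λ T → ¬? (anySubset? λ S → c (T ++ S) ≟ red))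
... | yes (T , none) = inj₂ (inj₁ (graphˡ (λ _ → T) (λ _ → ⊆-refl) λ S → ¬red⇒blue λ r → none (S , r)))
... | no all with anySubset? (λ T → c (T ++ ⊥) ≟ blue ×-dec
                       anySubset? (λ T′ → T ⊂? T′ ×-dec c (T′ ++ ⊤) ≟ blue))
...   | yes (T , b , T′ , T⊂T′ , b′) with far-pair T⊂T′ b b′
...     | inj₁ d = inj₁ d
...     | inj₂ q = inj₂ (inj₁ q)
-- Now every column has a red set, and a blue `R ++ ⊥` forces `T ++ ⊤` to be red whenever `R ⊂ T`.
brrb-arrows n c | no all | no near =
  inj₂ (inj₂ (graphʳ (λ T → g T (above? T) (c (T ++ ⊥) ≟ red))
    (λ {T} {T′} T⊆T′ → g-mono T⊆T′ (above? T) (above? T′) (c (T ++ ⊥) ≟ red) (c (T′ ++ ⊥) ≟ red))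
    λ T → g-red T (above? T) (c (T ++ ⊥) ≟ red)))
  where
  Above : Subset n → Set
  Above T = ∃[ R ] R ⊂ T × c (R ++ ⊥) ≡ blue

  above? : Decidable Above
  above? T = anySubset? λ R → R ⊂? T ×-dec c (R ++ ⊥) ≟ blue

  reds : ∀ T → ∃[ S ] c (T ++ S) ≡ red
  reds T = decidable-stable (anySubset? λ S → c (T ++ S) ≟ red) λ none → all (T , none)

  -- When T ++ ⊥ is blue, every proper superset of T is sent to ⊤, so any red set of the column of T will do.
  g : ∀ T → Dec (Above T) → Dec (c (T ++ ⊥) ≡ red) → Subset n
  g T (yes _) _       = ⊤
  g T (no _)  (yes _) = ⊥
  g T (no _)  (no _)  = proj₁ (reds T)

  g-mono : ∀ {T T′} → T ⊆ T′ → ∀ a a′ d d′ → g T a d ⊆ g T′ a′ d′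
  g-mono T⊆T′ _                 (yes _) _       _ = ⊆⊤
  g-mono T⊆T′ (yes (R , h , b)) (no ¬a) _       _ = ⊥-elim (¬a (R , ⊂-⊆-trans h T⊆T′ , b))
  g-mono T⊆T′ (no _)            (no _)  (yes _) _ = ⊥⊆
  g-mono {T} {T′} T⊆T′ (no _) (no ¬a) (no ¬r) d′ with T′ ⊆? T
  ... | no T′⊈T = ⊥-elim (¬a (T , ⊆∧⊉⇒⊂ T⊆T′ T′⊈T , ¬red⇒blue ¬r))
  g-mono {T} {T′} T⊆T′ (no _) (no ¬a) (no ¬r) d′ | yes T′⊆T with refl ← ⊆-antisym T⊆T′ T′⊆T | d′
  ...   | yes r = ⊥-elim (¬r r)
  ...   | no _  = ⊆-refl

  g-red : ∀ T a d → c (T ++ g T a d) ≡ red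
  g-red T (yes (R , R⊂T , b)) _       = ¬blue⇒red λ b′ → near (R , b , T , R⊂T , b′)
  g-red T (no _)              (yes r) = r
  g-red T (no _)              (no _)  = proj₂ (reds T)

-- The pattern rrbb

∪⁅⁆-⊉ : {A B : Subset n} {i : Fin n} → A ⊂ B → i ∉ B → B ⊈ A ∪ ⁅ i ⁆
∪⁅⁆-⊉ {A = A} {i = i} A⊂B i∉B B⊆ = ⊂⇒⊉ A⊂B λ {x} x∈B → case x∈B (x∈p∪q⁻ A ⁅ i ⁆ (B⊆ x∈B))
  where
  case : ∀ {x} → x ∈ _ → x ∈ A ⊎ x ∈ ⁅ i ⁆ → x ∈ A
  case x∈B (inj₁ x∈A) = x∈A
  case x∈B (inj₂ x∈i) with refl ← x∈⁅y⁆⇒x≡y i x∈i = ⊥-elim (i∉B x∈B)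

∪⁅⁆-⊈ : {A B : Subset n} {i : Fin n} → i ∉ B → A ∪ ⁅ i ⁆ ⊈ B
∪⁅⁆-⊈ {A = A} {i = i} i∉B h = i∉B (h (q⊆p∪q A ⁅ i ⁆ (x∈⁅x⁆ i)))

-- A ∪ ⁅ i ⁆ is incomparable to both B and C, so either colour of it completes a copy.
third-point : {c : Colouring N} {A B C D : Subset N} {i : Fin N} →
              A ⊂ B → B ⊆ D → A ⊂ C → C ⊆ D → i ∈ D → i ∉ B → i ∉ C →
              c A ≡ red → c B ≡ red → c C ≡ blue → c D ≡ blue → CopyOf Q2-rrbb c
third-point {c = c} {A} {B} {C} {D} {i} A⊂B B⊆D A⊂C C⊆D i∈D i∉B i∉C a b c′ d
  with c (A ∪ ⁅ i ⁆) ≟ red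
... | yes r = diamond (p⊆p∪q ⁅ i ⁆) (p⊂q⇒p⊆q A⊂C) (∪-least (⊆-trans (p⊂q⇒p⊆q A⊂C) C⊆D) (⁅⁆⊆ i∈D)) C⊆D
                      (∪⁅⁆-⊈ {A = A} i∉C) (∪⁅⁆-⊉ A⊂C i∉C) a r c′ d
... | no ¬r = diamond (p⊂q⇒p⊆q A⊂B) (p⊆p∪q ⁅ i ⁆) B⊆D (∪-least (⊆-trans (p⊂q⇒p⊆q A⊂C) C⊆D) (⁅⁆⊆ i∈D))
                      (∪⁅⁆-⊉ A⊂B i∉B) (∪⁅⁆-⊈ {A = A} i∉B) a b (¬red⇒blue ¬r) d

-- Incomparable `B` and `C` form the pattern directly. Otherwise an element of `D` outside the
-- larger one is outside both and feeds `third-point`.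
two-coloured-interval : {c : Colouring N} {A B C D : Subset N} →
                        A ⊂ B → B ⊂ D → A ⊂ C → C ⊂ D →
                        c A ≡ red → c B ≡ red → c C ≡ blue → c D ≡ blue → CopyOf Q2-rrbb c
two-coloured-interval {B = B} {C} A⊂B (B⊆D , i , i∈D , i∉B) A⊂C (C⊆D , j , j∈D , j∉C) a b c d
  with B ⊆? C | C ⊆? B
... | no B⊈C  | no C⊈B  = diamond (p⊂q⇒p⊆q A⊂B) (p⊂q⇒p⊆q A⊂C) B⊆D C⊆D B⊈C C⊈B a b c d
... | yes B⊆C | _       = third-point A⊂B B⊆D A⊂C C⊆D j∈D (λ j∈B → j∉C (B⊆C j∈B)) j∉C a b c d
... | no _    | yes C⊆B = third-point A⊂B B⊆D A⊂C C⊆D i∈D i∉B (λ i∈C → i∉B (C⊆B i∈C)) a b c d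

lift : Subset n → {A : Set} → Dec A → Subset n
lift d (yes _) = d
lift d (no  _) = ⊥

lift-mono : (d : Subset n) {A B : Set} (p : Dec A) (q : Dec B) → (A → B) → lift d p ⊆ lift d q
lift-mono d (yes _) (yes _) f = ⊆-refl
lift-mono d (yes a) (no ¬b) f = ⊥-elim (¬b (f a))
lift-mono d (no _)  _       f = ⊥⊆

-- Among the sets `S ++ ⊥` only the one over `⊤` may be red. A blue set in the column of `⊤`
-- replaces it; if there is none, that column is a red copy.
top-case : ∀ {m n} {c : Colouring (m + n)} → (∀ S → ⊤ ⊈ S → c (S ++ ⊥) ≡ blue) →
           CopyOf (mono {m} blue) c ⊎ CopyOf (mono {n} red) c
top-case {c = c} proper with anySubset? (λ D → c (⊤ ++ D) ≟ blue)
... | no none = inj₂ (graphˡ (λ _ → ⊤) (λ _ → ⊆-refl) λ D → ¬blue⇒red λ b → none (D , b))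
... | yes (D , b) = inj₁ (graphʳ (λ S → lift D (⊤ ⊆? S))
    (λ {S} {T} S⊆T → lift-mono D (⊤ ⊆? S) (⊤ ⊆? T) λ ⊤⊆S → ⊆-trans ⊤⊆S S⊆T) λ S → col S (⊤ ⊆? S))
  where
  col : ∀ S (p : Dec (⊤ ⊆ S)) → c (S ++ lift D p) ≡ blue
  col S (yes ⊤⊆S) with refl ← ⊆-antisym ⊤⊆S ⊆⊤ = b
  col S (no ⊤⊈S)  = proper S ⊤⊈S

⊂⇒++⊂ˡ : {p p′ : Subset m} {q q′ : Subset n} → p ⊂ p′ → q ⊆ q′ → p ++ q ⊂ p′ ++ q′
⊂⇒++⊂ˡ p⊂p′ q⊆q′ = ⊆∧⊉⇒⊂ (++-⊆ (p⊂q⇒p⊆q p⊂p′) q⊆q′) λ h → ⊂⇒⊉ p⊂p′ (++-⊆ˡ h)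

⊂⇒++⊂ʳ : {p p′ : Subset m} {q q′ : Subset n} → p ⊆ p′ → q ⊂ q′ → p ++ q ⊂ p′ ++ q′
⊂⇒++⊂ʳ {p = p} {p′} p⊆p′ q⊂q′ = ⊆∧⊉⇒⊂ (++-⊆ p⊆p′ (p⊂q⇒p⊆q q⊂q′)) λ h → ⊂⇒⊉ q⊂q′ (++-⊆ʳ p′ p h)

⊥⊂ : {x : Fin n} {p : Subset n} → x ∈ p → ⊥ ⊂ p
⊥⊂ {x = x} x∈p = ⊥⊆ , x , x∈p , ∉⊥

module _ {m n} (c : Colouring (m + n)) {A : Subset m} {T₀ T₁ : Subset n} {z : Fin n}
         (A⊂⊤ : A ⊂ ⊤) (a : c (A ++ ⊥) ≡ red) (A-min : ∀ {S} → S ⊂ A → c (S ++ ⊥) ≢ red)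
         (T₀⊆T₁ : T₀ ⊆ T₁) (z∈T₀ : z ∈ T₀)
         (b₀ : c (A ++ T₀) ≡ blue) (b₁ : c (⊤ ++ T₁) ≡ blue) where

  private
    HasRed : Subset m → Set
    HasRed S = ∃[ R ] R ⊆ S × c (R ++ ⊥) ≡ red

    hasRed? : Decidable HasRed
    hasRed? S = anySubset? λ R → R ⊆? S ×-dec c (R ++ ⊥) ≟ red

    -- `A ++ T₀` is a blue interior point, so one red interior point makes the interval
    -- two-coloured.
    red-interior : ∀ {B} → (A ++ ⊥) ⊂ B → B ⊂ (⊤ ++ T₁) → c B ≡ red → CopyOf Q2-rrbb c
    red-interior A⊂B B⊂Z r = two-coloured-interval A⊂B B⊂Z
      (⊂⇒++⊂ʳ (⊆-refl {x = A}) (⊥⊂ z∈T₀)) (⊂⇒++⊂ˡ A⊂⊤ T₀⊆T₁) a r b₀ b₁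

    red-lift : ∀ {S} → HasRed S → c (S ++ ⁅ z ⁆) ≡ red → CopyOf Q2-rrbb c
    red-lift {S} (R , R⊆S , r) s = go (A ⊆? S)
      where
      S⊂Z : (S ++ ⁅ z ⁆) ⊂ (⊤ ++ T₁)
      S⊂Z = ⊆∧≢⇒⊂ (++-⊆ ⊆⊤ (⁅⁆⊆ (T₀⊆T₁ z∈T₀))) λ eq → clash b₁ (trans (cong c (sym eq)) s)

      go : Dec (A ⊆ S) → CopyOf Q2-rrbb c
      go (yes A⊆S) = red-interior (⊂⇒++⊂ʳ A⊆S (⊥⊂ (x∈⁅x⁆ z))) S⊂Z s
      -- If `(R ∪ A) ++ ⊥` is red, it is strictly above `A ++ ⊥`, as otherwise `R ⊂ A` against
      -- minimality. If blue, it and the red `S ++ ⁅ z ⁆` lie inside the interval from `R ++ ⊥` to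
      -- `⊤ ++ T₁`.
      go (no A⊈S) with c ((R ∪ A) ++ ⊥) ≟ red
      ... | yes u = red-interior
              (⊂⇒++⊂ˡ (⊆∧⊉⇒⊂ (q⊆p∪q R A) λ h → A-min (⊆∧⊉⇒⊂ (⊆-trans (p⊆p∪q A) h) A⊈R) r) ⊆-refl)
              (⊂⇒++⊂ʳ ⊆⊤ (⊥⊂ (T₀⊆T₁ z∈T₀))) u
        where
        A⊈R : A ⊈ R
        A⊈R A⊆R = A⊈S (⊆-trans A⊆R R⊆S)
      ... | no ¬u = two-coloured-interval (⊂⇒++⊂ʳ R⊆S (⊥⊂ (x∈⁅x⁆ z))) S⊂Z
              (⊂⇒++⊂ˡ (⊆∧⊉⇒⊂ (p⊆p∪q A) λ h → A⊈S (⊆-trans (q⊆p∪q R A) (⊆-trans h R⊆S))) ⊆-refl)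
              (⊂⇒++⊂ʳ ⊆⊤ (⊥⊂ (T₀⊆T₁ z∈T₀))) r s (¬red⇒blue ¬u) b₁

  minimal-red-case : CopyOf Q2-rrbb c ⊎ CopyOf (mono {m} blue) c
  minimal-red-case with anySubset? (λ S → hasRed? S ×-dec c (S ++ ⁅ z ⁆) ≟ red)
  ... | yes (S , h , s) = inj₁ (red-lift h s)
  ... | no none = inj₂ (graphʳ (λ S → lift ⁅ z ⁆ (hasRed? S))
          (λ {S} {T} S⊆T → lift-mono ⁅ z ⁆ (hasRed? S) (hasRed? T)
            λ { (R , R⊆S , r) → R , ⊆-trans R⊆S S⊆T , r })
          λ S → col S (hasRed? S))
    where
    col : ∀ S (p : Dec (HasRed S)) → c (S ++ lift ⁅ z ⁆ p) ≡ blue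
    col S (yes h) = ¬red⇒blue λ s → none (S , h , s)
    col S (no ¬h) = ¬red⇒blue λ r → ¬h (S , ⊆-refl , r)

-- With k = 1 the chain lemma turns these two steps into blue sets `A ++ T₀` and `⊤ ++ T₁` with
-- `T₀ ⊆ T₁`.
raise : Subset m → ℕ → Subset m
raise A zero    = A
raise A (suc _) = ⊤

raise-mono : (A : Subset m) {i j : ℕ} → i ≤ j → raise A i ⊆ raise A j
raise-mono A {j = zero}  z≤n     = ⊆-refl
raise-mono A {j = suc _} z≤n     = ⊆⊤
raise-mono A             (s≤s _) = ⊆-refl

rrbb-arrows : ∀ n → Arrows Q2-rrbb n (n + n)
-- `⊤` is excluded because the interval argument needs `A ⊂ ⊤`; `top-case` covers the rest.
rrbb-arrows n c with anySubset? (λ S → c (S ++ ⊥) ≟ red ×-dec ¬? (⊤ ⊆? S))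
... | no none with top-case {n} {n} {c} (λ S ⊤⊈S → ¬red⇒blue λ r → none (S , r , ⊤⊈S))
...   | inj₁ q = inj₂ (inj₁ q)
...   | inj₂ q = inj₂ (inj₂ q)
rrbb-arrows n c | yes proper
  with A , (a , ⊤⊈A) , A-min ← minimal (λ S → c (S ++ ⊥) ≟ red ×-dec ¬? (⊤ ⊆? S)) proper
  with chain-lemma c (λ T i → raise A i ++ T)
    (λ S⊆T i≤j → ++-⊆ (raise-mono A i≤j) S⊆T)
    (λ {S} {T} {i} {j} h → ++-⊆ʳ (raise A i) (raise A j) h) 1
... | inj₁ q = inj₂ (inj₂ q)
... | inj₂ C with nonempty? (BlueChain.level C 0)
...   | no empty = clash (BlueChain.level-blue C z≤n)
                     (subst (λ T → c (A ++ T) ≡ red) (sym (Empty-unique empty)) a)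
...   | yes (z , z∈T₀) with minimal-red-case c (⊆∧⊉⇒⊂ ⊆⊤ ⊤⊈A) a
            -- Minimality among proper red sets covers every `S ⊂ A`, since such an `S` is not `⊤`.
            (λ { (S⊆A , x , x∈A , x∉S) r → A-min (S⊆A , x , x∈A , x∉S) (r , λ ⊤⊆S → x∉S (⊤⊆S ∈⊤)) })
            (level-mono z≤n) z∈T₀ (level-blue z≤n) (level-blue ℕ.≤-refl)
  where open BlueChain C
...     | inj₁ q = inj₁ q
...     | inj₂ q = inj₂ (inj₁ q)

-- The pattern rbbb

-- The j new coordinates are inserted one at a time, at the times recorded by w, into the chain of the
-- initial segments of q coordinates.
insertion-chain : ∀ {q j} → Vec (Fin q) j → ℕ → Subset (j + q)
insertion-chain {q} []      i = initial q i
insertion-chain     (p ∷ w) i with i ≤? Fin.toℕ p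
... | yes _ = outside ∷ insertion-chain w i
... | no  _ = inside ∷ insertion-chain w (i ∸ 1)

module _ {q : ℕ} where

  insertion-chain-mono : ∀ {j} (w : Vec (Fin q) j) {i i′} → i ≤ i′ → insertion-chain w i ⊆ insertion-chain w i′
  insertion-chain-mono []      i≤i′ = initial-mono q i≤i′
  insertion-chain-mono (p ∷ w) {i} {i′} i≤i′ with i ≤? Fin.toℕ p | i′ ≤? Fin.toℕ p
  ... | yes _   | yes _    = out⊆ (insertion-chain-mono w i≤i′)
  ... | yes i≤p | no i′≰p  = out⊆ (insertion-chain-mono w (ℕ.≤-trans i≤p (ℕ.∸-monoˡ-≤ 1 (ℕ.≰⇒> i′≰p))))
  ... | no _    | no _     = in⊆in (insertion-chain-mono w (ℕ.∸-monoˡ-≤ 1 i≤i′))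
  ... | no i≰p  | yes i′≤p = ⊥-elim (i≰p (ℕ.≤-trans i≤i′ i′≤p))

  -- Hence members of equal rank in two such chains are incomparable as soon as they differ.
  ∣insertion-chain∣ : ∀ {j} (w : Vec (Fin q) j) {i} → i ≤ j + q → ∣ insertion-chain w i ∣ ≡ i
  ∣insertion-chain∣         []      i≤q = ∣initial∣ q i≤q
  ∣insertion-chain∣ {suc j} (p ∷ w) {i} i≤ with i ≤? Fin.toℕ p
  ... | yes i≤p = ∣insertion-chain∣ w (ℕ.≤-trans i≤p (ℕ.≤-trans (ℕ.<⇒≤ (Fin.toℕ<n p)) (ℕ.m≤n+m q j)))
  ∣insertion-chain∣ (p ∷ w) {zero}  i≤ | no i≰p = ⊥-elim (i≰p z≤n)
  ∣insertion-chain∣ (p ∷ w) {suc i} i≤ | no i≰p = cong suc (∣insertion-chain∣ w (s≤s⁻¹ i≤))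

  -- At rank p + 1 the first chain has inserted its new coordinate, while the second, with p′ ≥ p +
  -- 1, has not.
  head-differs : ∀ {j} {p p′ : Fin q} (w w′ : Vec (Fin q) j) → p Fin.< p′ →
                 ∃[ i ] i ≤ suc j + q × insertion-chain (p ∷ w) i ≢ insertion-chain (p′ ∷ w′) i
  head-differs {j} {p} {p′} w w′ p<p′ = suc (Fin.toℕ p) ,
    ℕ.≤-trans (Fin.toℕ<n p) (ℕ.m≤n+m q (suc j)) , ne
    where
    ne : insertion-chain (p ∷ w) (suc (Fin.toℕ p)) ≢ insertion-chain (p′ ∷ w′) (suc (Fin.toℕ p))
    ne eq with suc (Fin.toℕ p) ≤? Fin.toℕ p | suc (Fin.toℕ p) ≤? Fin.toℕ p′
    ... | yes p<p | _        = ℕ.<-irrefl refl p<p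
    ... | no _    | no p≮p′  = p≮p′ p<p′
    ne () | no _  | yes _

  insertion-chains-differ : ∀ {j} (w w′ : Vec (Fin q) j) → w ≢ w′ →
                            ∃[ i ] i ≤ j + q × insertion-chain w i ≢ insertion-chain w′ i
  insertion-chains-differ []      []        w≢w′ = ⊥-elim (w≢w′ refl)
  insertion-chains-differ {suc j} (p ∷ w) (p′ ∷ w′) w≢w′ with Fin.<-cmp p p′
  ... | tri< p<p′ _ _ = head-differs w w′ p<p′
  ... | tri> _ _ p>p′ with i , i≤ , ne ← head-differs w′ w p>p′ = i , i≤ , λ eq → ne (sym eq)
  ... | tri≈ _ refl _ with i , i≤ , ne ← insertion-chains-differ w w′ (λ eq → w≢w′ (cong (p ∷_) eq)) = go
    where
    go : ∃[ i ] i ≤ suc j + q × insertion-chain (p ∷ w) i ≢ insertion-chain (p ∷ w′) i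
    -- A difference of the tails at rank `i` shows at rank `i` before the common insertion and at
    -- rank i + 1 after it.
    go with i ≤? Fin.toℕ p in d
    ... | yes _  = i , ℕ.m≤n⇒m≤1+n i≤ , early
      where
      early : insertion-chain (p ∷ w) i ≢ insertion-chain (p ∷ w′) i
      early eq rewrite d = ne (∷-injectiveʳ eq)
    ... | no i≰p = suc i , s≤s i≤ , late
      where
      late : insertion-chain (p ∷ w) (suc i) ≢ insertion-chain (p ∷ w′) (suc i)
      late eq with suc i ≤? Fin.toℕ p
      ... | yes i<p = i≰p (ℕ.<⇒≤ i<p)
      ... | no _    = ne (∷-injectiveʳ eq)

-- Base-`q` digits number the insertion words for the pigeonhole principle on `Fin`.
decode : ∀ q j → Fin (q ^ j) → Vec (Fin q) j
decode q zero    _ = []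
decode q (suc j) x = proj₁ (Fin.remQuot {q} (q ^ j) x) ∷ decode q j (proj₂ (Fin.remQuot {q} (q ^ j) x))

decode-injective : ∀ q j {x y} → decode q j x ≡ decode q j y → x ≡ y
decode-injective q zero    {zero} {zero} _ = refl
decode-injective q (suc j) {x} {y} eq =
  trans (sym (Fin.combine-remQuot {q} (q ^ j) x))
    (trans (cong₂ Fin.combine (∷-injectiveˡ eq) (decode-injective q j (∷-injectiveʳ eq)))
           (Fin.combine-remQuot {q} (q ^ j) y))

encode : Subset n → Fin (2 ^ n)
encode []            = zero
encode (inside ∷ S)  = Fin.combine {2} zero (encode S)
encode (outside ∷ S) = Fin.combine {2} (suc zero) (encode S)

encode-injective : (S T : Subset n) → encode S ≡ encode T → S ≡ T
encode-injective []            []            _  = refl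
encode-injective (inside ∷ S)  (inside ∷ T)  eq = cong (inside ∷_) (encode-injective S T (Fin.combine-injectiveʳ {2} zero _ zero _ eq))
encode-injective (outside ∷ S) (outside ∷ T) eq = cong (outside ∷_) (encode-injective S T (Fin.combine-injectiveʳ {2} (suc zero) _ (suc zero) _ eq))
encode-injective (inside ∷ S)  (outside ∷ T) eq with () ← Fin.combine-injectiveˡ {2} zero (encode S) (suc zero) (encode T) eq
encode-injective (outside ∷ S) (inside ∷ T)  eq with () ← Fin.combine-injectiveˡ {2} (suc zero) (encode S) zero (encode T) eq

-- A finite search settles this constructively. It serves to obtain a red copy or a blue chain for
-- every word at once.
all-or : ∀ n {A : Set} {B : Fin n → Set} → (∀ x → A ⊎ B x) → A ⊎ (∀ x → B x)
all-or zero    f = inj₂ λ ()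
all-or (suc n) f with f zero | all-or n (λ x → f (suc x))
... | inj₁ a | _      = inj₁ a
... | inj₂ _ | inj₁ a = inj₁ a
... | inj₂ b | inj₂ g = inj₂ λ { zero → b ; (suc x) → g x }

rbbb-arrows : ∀ n q j → 2 ^ n < q ^ j → Arrows Q2-rbbb n (n + (n + (j + q)))
rbbb-arrows n q j 2^n<q^j c with anySubset? (λ S → c (S ++ ⊥) ≟ red)
... | no none = inj₂ (inj₁ (graphʳ (λ _ → ⊥) (λ _ → ⊆-refl) λ S → ¬red⇒blue λ r → none (S , r)))
-- Holding the first block at `⊤` puts the whole family above the red `A ++ ⊥`.
... | yes (A , a) with all-or (q ^ j) (λ x → chain-lemma c (λ (T : Subset n) i → ⊤ {n} ++ (T ++ insertion-chain (decode q j x) i))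
      (λ S⊆T i≤j → ++-⊆ {p = ⊤ {n}} ⊆-refl (++-⊆ S⊆T (insertion-chain-mono (decode q j x) i≤j)))
      (λ h → ++-⊆ˡ (++-⊆ʳ (⊤ {n}) ⊤ h)) (j + q))
...   | inj₁ r = inj₂ (inj₂ r)
...   | inj₂ C
  -- Two words share the top level, which has at most `2 ^ n` values. At rank j + q both insertion
  -- chains are `⊤`, so the tops coincide.
  with x , y , x<y , eq ← Fin.pigeonhole 2^n<q^j (λ x → encode (BlueChain.level (C x) (j + q)))
  with i , i≤ , ne ← insertion-chains-differ (decode q j x) (decode q j y)
                       (λ eq → Fin.<-irrefl (decode-injective q j eq) x<y)
  = inj₁ (diamond
      (++-⊆ (⊆⊤ {p = A}) ⊥⊆) (++-⊆ (⊆⊤ {p = A}) ⊥⊆)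
      (++-⊆ {p = ⊤ {n}} ⊆-refl (++-⊆ (X.level-mono i≤) (insertion-chain-mono w i≤)))
      (++-⊆ {p = ⊤ {n}} ⊆-refl (++-⊆ (subst (Y.level i ⊆_) (sym top) (Y.level-mono i≤)) (subst (insertion-chain w′ i ⊆_) (sym full) ⊆⊤)))
      (λ h → ne (⊆∧∣∣≡⇒≡ (++-⊆ʳ (X.level i) _ (++-⊆ʳ (⊤ {n}) ⊤ h)) sizes))
      (λ h → ne (sym (⊆∧∣∣≡⇒≡ (++-⊆ʳ (Y.level i) _ (++-⊆ʳ (⊤ {n}) ⊤ h)) (sym sizes))))
      a (X.level-blue i≤) (Y.level-blue i≤) (X.level-blue ℕ.≤-refl))
  where
  module X = BlueChain (C x)
  module Y = BlueChain (C y)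
  w w′ : Vec (Fin q) j
  w  = decode q j x
  w′ = decode q j y
  top : X.level (j + q) ≡ Y.level (j + q)
  top = encode-injective _ _ eq
  full : insertion-chain w (j + q) ≡ ⊤
  full = ∣p∣≡n⇒p≡⊤ (∣insertion-chain∣ w ℕ.≤-refl)
  sizes : ∣ insertion-chain w i ∣ ≡ ∣ insertion-chain w′ i ∣
  sizes = trans (∣insertion-chain∣ w i≤) (sym (∣insertion-chain∣ w′ i≤))

-- Arithmetic of the O(n / log n) term

2^⌊log₂n⌋≤n : ∀ n → 1 ≤ n → 2 ^ ⌊log₂ n ⌋ ≤ n
2^⌊log₂n⌋≤n n 1≤n = go n n ℕ.≤-refl 1≤n
  where
  open ℕ.≤-Reasoning
  go : ∀ b n → n ≤ b → 1 ≤ n → 2 ^ ⌊log₂ n ⌋ ≤ n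
  go b       (suc zero)      _   _ = ℕ.≤-refl
  go (suc b) n@(suc (suc m)) n≤b _ = begin
    2 ^ ⌊log₂ n ⌋              ≤⟨ ℕ.^-monoʳ-≤ 2 (ℕ.m≤n+m∸n ⌊log₂ n ⌋ 1) ⟩
    2 * 2 ^ (⌊log₂ n ⌋ ∸ 1)    ≡⟨ cong (λ l → 2 * 2 ^ l) (sym (⌊log₂⌊n/2⌋⌋≡⌊log₂n⌋∸1 n)) ⟩
    2 * 2 ^ ⌊log₂ ⌊ n /2⌋ ⌋    ≤⟨ ℕ.*-monoʳ-≤ 2 (go b ⌊ n /2⌋ (ℕ.≤-trans (s≤s⁻¹ (ℕ.⌊n/2⌋<n (suc m))) (s≤s⁻¹ n≤b)) (s≤s z≤n)) ⟩
    2 * ⌊ n /2⌋                ≡⟨ cong (⌊ n /2⌋ +_) (ℕ.+-identityʳ _) ⟩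
    ⌊ n /2⌋ + ⌊ n /2⌋          ≤⟨ ℕ.+-monoʳ-≤ ⌊ n /2⌋ (ℕ.⌊n/2⌋≤⌈n/2⌉ n) ⟩
    ⌊ n /2⌋ + ⌈ n /2⌉          ≡⟨ ℕ.⌊n/2⌋+⌈n/2⌉≡n n ⟩
    n                          ∎

n<2^n : ∀ n → n < 2 ^ n
n<2^n zero    = s≤s z≤n
n<2^n (suc n) = ℕ.≤-trans (ℕ.+-mono-≤ (ℕ.m^n>0 2 n) (n<2^n n)) (ℕ.≤-reflexive (cong (2 ^ n +_) (sym (ℕ.+-identityʳ _))))

-- With l = ⌊log₂ n⌋ and q = 2 ^ s for s = ⌊l/2⌋, so that q * l is still O(n), the n/s + 1 insertions
-- give q ^ (n/s + 1) > 2 ^ n chains.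
rbbb-upper : ∀ n → 4 ≤ n → ∃[ N ] (Arrows Q2-rbbb n N × N * ⌊log₂ n ⌋ ≤ 2 * n * ⌊log₂ n ⌋ + 8 * n)
rbbb-upper n 4≤n = n + (n + (j + q)) , rbbb-arrows n q j 2^n<q^j , bound
  where
  open ℕ.≤-Reasoning
  l s q j : ℕ
  l = ⌊log₂ n ⌋
  s = ⌊ l /2⌋

  1≤s : 1 ≤ s
  1≤s = ℕ.⌊n/2⌋-mono (⌊log₂⌋-mono-≤ 4≤n)

  instance
    s≢0 : NonZero s
    s≢0 = >-nonZero 1≤s

  q = 2 ^ s
  j = suc (n / s)

  n<s*j : n < s * j
  n<s*j = begin-strict
    n                     ≡⟨ m≡m%n+[m/n]*n n s ⟩
    n % s + n / s * s     <⟨ ℕ.+-monoˡ-< (n / s * s) (m%n<n n s) ⟩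
    s + n / s * s         ≡⟨ ℕ.*-comm j s ⟩
    s * j                 ∎

  2^n<q^j : 2 ^ n < q ^ j
  2^n<q^j = begin-strict
    2 ^ n          <⟨ ℕ.^-monoʳ-< 2 ℕ.≤-refl n<s*j ⟩
    2 ^ (s * j)    ≡⟨ sym (ℕ.^-*-assoc 2 s j) ⟩
    q ^ j          ∎

  l≤1+s+s : l ≤ suc (s + s)
  l≤1+s+s = begin
    l                    ≡⟨ sym (ℕ.⌊n/2⌋+⌈n/2⌉≡n l) ⟩
    s + ⌈ l /2⌉          ≤⟨ ℕ.+-monoʳ-≤ s (ceil l) ⟩
    s + suc s            ≡⟨ ℕ.+-suc s s ⟩
    suc (s + s)          ∎
    where
    ceil : ∀ l → ⌈ l /2⌉ ≤ suc ⌊ l /2⌋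
    ceil zero          = z≤n
    ceil (suc zero)    = ℕ.≤-refl
    ceil (suc (suc l)) = s≤s (ceil l)

  l≤s*3 : l ≤ s * 3
  l≤s*3 = begin
    l               ≤⟨ l≤1+s+s ⟩
    suc (s + s)     ≤⟨ ℕ.+-monoˡ-≤ (s + s) 1≤s ⟩
    s + (s + s)     ≡⟨ solve 1 (λ s → s :+ (s :+ s) := s :* con 3) refl s ⟩
    s * 3           ∎

  q*q≤n : q * q ≤ n
  q*q≤n = begin
    q * q           ≡⟨ sym (ℕ.^-distribˡ-+-* 2 s s) ⟩
    2 ^ (s + s)     ≤⟨ ℕ.^-monoʳ-≤ 2 (ℕ.≤-trans (ℕ.+-monoʳ-≤ s (ℕ.⌊n/2⌋≤⌈n/2⌉ l)) (ℕ.≤-reflexive (ℕ.⌊n/2⌋+⌈n/2⌉≡n l))) ⟩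
    2 ^ l           ≤⟨ 2^⌊log₂n⌋≤n n (ℕ.≤-trans (s≤s z≤n) 4≤n) ⟩
    n               ∎

  s<q : s < q
  s<q = n<2^n s

  s≤n : s ≤ n
  s≤n = begin
    s        ≤⟨ ℕ.<⇒≤ s<q ⟩
    q        ≤⟨ ℕ.m≤m*n q q {{ℕ.m^n≢0 2 s}} ⟩
    q * q    ≤⟨ q*q≤n ⟩
    n        ∎

  -- Combines j s ≤ 2n with l ≤ 3s.
  j*l≤6n : j * l ≤ 6 * n
  j*l≤6n = begin
    j * l                ≤⟨ ℕ.*-monoʳ-≤ j l≤s*3 ⟩
    j * (s * 3)          ≡⟨ solve 2 (λ d s → (con 1 :+ d) :* (s :* con 3) := con 3 :* (s :+ d :* s)) refl (n / s) s ⟩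
    3 * (s + n / s * s)  ≤⟨ ℕ.*-monoʳ-≤ 3 (ℕ.+-mono-≤ s≤n (m/n*n≤m n s)) ⟩
    3 * (n + n)          ≡⟨ solve 1 (λ n → con 3 :* (n :+ n) := con 6 :* n) refl n ⟩
    6 * n                ∎

  -- Combines l ≤ 2q with q² ≤ n.
  q*l≤2n : q * l ≤ 2 * n
  q*l≤2n = begin
    q * l                ≤⟨ ℕ.*-monoʳ-≤ q (ℕ.≤-trans l≤1+s+s (ℕ.+-mono-≤ s<q (ℕ.<⇒≤ s<q))) ⟩
    q * (q + q)          ≡⟨ solve 1 (λ q → q :* (q :+ q) := con 2 :* (q :* q)) refl q ⟩
    2 * (q * q)          ≤⟨ ℕ.*-monoʳ-≤ 2 q*q≤n ⟩
    2 * n                ∎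

  bound : (n + (n + (j + q))) * l ≤ 2 * n * l + 8 * n
  bound = begin
    (n + (n + (j + q))) * l         ≡⟨ solve 4 (λ n j q l → (n :+ (n :+ (j :+ q))) :* l := con 2 :* n :* l :+ (j :* l :+ q :* l)) refl n j q l ⟩
    2 * n * l + (j * l + q * l)     ≤⟨ ℕ.+-monoʳ-≤ (2 * n * l) (ℕ.+-mono-≤ j*l≤6n q*l≤2n) ⟩
    2 * n * l + (6 * n + 2 * n)     ≡⟨ cong (2 * n * l +_) (sym (ℕ.*-distribʳ-+ n 6 2)) ⟩
    2 * n * l + 8 * n               ∎

-- Assembling the exact values and the theorem

exact : {col : Subset k → Colour} {S T : Subset k} → S ⊆ T → col S ≡ red → col T ≡ blue →
        (∀ n → Arrows col n (n + n)) → ∀ n → IsRtilde col n (2 * n)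
exact {col = col} {S} {T} S⊆T colS colT upper n =
  subst (Arrows col n) (cong (n +_) (sym (ℕ.+-identityʳ n))) (upper n) ,
  lower-bound {col = col} {S} {T} S⊆T colS colT n

theorem6 : (∀ n → IsRtilde Q2-brbb n (2 * n))
    × (∀ n → IsRtilde Q2-brrb n (2 * n))
    × (∀ n → IsRtilde Q2-rrbb n (2 * n))
    × (∀ n → ∀ M → M < 2 * n → ¬ Arrows Q2-rbbb n M)
    × (∃[ C ] ∃[ n₀ ] ∀ n → n₀ ≤ n →
    ∃[ N ] (Arrows Q2-rbbb n N
    × N * ⌊log₂ n ⌋ ≤ 2 * n * ⌊log₂ n ⌋ + C * n))
theorem6 =
    -- The minimum is blue in brbb and brrb, so the red vertex below the blue top is the middle one
    -- {1}; in rrbb and rbbb it is the minimum.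
    exact {S = inside ∷ outside ∷ []} {⊤} ⊆⊤ refl refl brbb-arrows
  , exact {S = inside ∷ outside ∷ []} {⊤} ⊆⊤ refl refl brrb-arrows
  , exact {S = ⊥} {⊤} ⊆⊤ refl refl rrbb-arrows
  , lower-bound {col = Q2-rbbb} {⊥} {⊤} ⊆⊤ refl refl
  -- 8 = 6 + 2 adds the shares of `j` and `q`; n ≥ 4 makes the divisor `s` positive.
  , 8 , 4 , rbbb-upper
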